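{- Let $G$ and $H$ be graphs with $\chi(G)<\chi(H)$. Then for all integers $q\geq 2$ there exists a graph $F$ such that $F\rightarrow (G)_q$ and $F\not\rightarrow (H)_q$.
   Context: Graphs are finite and simple. $\chi(G)$ denotes the chromatic number of $G$, i.e. the minimum number of colours in a vertex colouring of $G$ in which no two adjacent vertices receive the same colour. For an integer $q\geq 2$ and graphs $F$ and $G$, $F\rightarrow (G)_q$ ("$F$ is $q$-Ramsey for $G$") means that every colouring of the edges of $F$ in $q$ colours contains a monochromatic copy of $G$, that is, a (not necessarily induced) subgraph of $F$ isomorphic to $G$ all of whose edges have the same colour. $F\not\rightarrow (G)_q$ means that $F$ is not $q$-Ramsey for $G$. -}

module Defs where

open import Data.Bool.Base using (Bool; T)
open import Data.Bool.Properties using (T?)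
open import Data.Fin.Base using (Fin; finToFun; funToFin)
open import Data.Fin.Properties using (_≟_; all?; any?; finToFun-funToFin)
open import Data.Fin.Subset using (Subset; _∈_)
open import Data.Nat.Base using (ℕ; zero; suc; _≤_; _^_; z≤n; s≤s)
open import Data.Product.Base using (Σ-syntax; ∃; ∃-syntax; _×_; _,_; proj₁; proj₂)
open import Function.Base using (id; _∘_)
open import Function.Bundles using (_⇔_)
open import Function.Definitions using (Injective)
open import Relation.Binary.PropositionalEquality using (_≡_; _≢_; refl; sym; trans)
open import Relation.Nullary using (¬_; Dec; yes; no; contradiction)
open import Relation.Nullary.Decidable using (map′; ¬?; _→-dec_)
open import Relation.Unary using (Decidable)

-- Adjacency is Boolean-valued so that it is decidable and each pair of
-- vertices carries at most one edge.
record Graph : Set where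
  field
    order     : ℕ
    adj       : Fin order → Fin order → Bool
    adj-sym   : ∀ u v → T (adj u v) → T (adj v u)
    adj-irrefl : ∀ v → ¬ T (adj v v)

  Vertex : Set
  Vertex = Fin order

  Adj : Vertex → Vertex → Set
  Adj u v = T (adj u v)

open Graph public using (Vertex; Adj)

Proper : (G : Graph) {k : ℕ} → (Vertex G → Fin k) → Set
Proper G c = ∀ u v → Adj G u v → c u ≢ c v

Colourable : Graph → ℕ → Set
Colourable G k = ∃[ c ] Proper G {k} c

IsChromaticNumber : Graph → ℕ → Set
IsChromaticNumber G k = Colourable G k × (∀ m → Colourable G m → k ≤ m)

proper? : (G : Graph) {k : ℕ} (c : Vertex G → Fin k) → Dec (Proper G c)
proper? G c =
  all? λ u → all? λ v → T? (Graph.adj G u v) →-dec ¬? (c u ≟ c v)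

colourable? : (G : Graph) → Decidable (Colourable G)
colourable? G k = map′ to from (any? λ i → proper? G (decode i))
  where
  decode : Fin (k ^ Graph.order G) → Vertex G → Fin k
  decode = finToFun

  to : ∃[ i ] Proper G (decode i) → Colourable G k
  to (i , p) = decode i , p

  from : Colourable G k → ∃[ i ] Proper G (decode i)
  from (c , p) = funToFin c , λ u v e eq →
    p u v e (trans (sym (finToFun-funToFin c u)) (trans eq (finToFun-funToFin c v)))

least : {P : ℕ → Set} → Decidable P → ∀ n → P n → ∃[ k ] (P k × (∀ m → P m → k ≤ m))
least P? n pn with P? 0
least P? n       pn | yes p0 = 0 , p0 , λ _ _ → z≤n
least P? zero    pn | no ¬p0 = contradiction pn ¬p0
least {P} P? (suc n) pn | no ¬p0 with least (P? ∘ suc) n pn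
... | k , pk , min = suc k , pk , min′
  where
  min′ : ∀ m → P m → suc k ≤ m
  min′ zero    p = contradiction p ¬p0
  min′ (suc m) p = s≤s (min m p)

chromaticNumber : (G : Graph) → ∃ (IsChromaticNumber G)
chromaticNumber G = least (colourable? G) (Graph.order G) (id , distinct)
  where
  distinct : Proper G id
  distinct u .u e refl = Graph.adj-irrefl G u e

χ : Graph → ℕ
χ G = proj₁ (chromaticNumber G)

χ-isChromaticNumber : ∀ G → IsChromaticNumber G (χ G)
χ-isChromaticNumber G = proj₂ (chromaticNumber G)

-- Not necessarily induced: `edge` may omit edges of F between chosen vertices.
record Subgraph (F : Graph) : Set where
  field
    vertices : Subset (Graph.order F)
    edge     : Vertex F → Vertex F → Bool
    edge-sym : ∀ u v → T (edge u v) → T (edge v u)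
    edge-ends : ∀ u v → T (edge u v) → u ∈ vertices × v ∈ vertices
    edge⊆Adj : ∀ u v → T (edge u v) → Adj F u v

  Edge : Vertex F → Vertex F → Set
  Edge u v = T (edge u v)

-- An isomorphism from G onto a subgraph S of F, as a map into the vertices of F
-- whose image is the vertex set of S.
record _≅_ (G : Graph) {F : Graph} (S : Subgraph F) : Set where
  open Subgraph S
  field
    to        : Vertex G → Vertex F
    injective : Injective _≡_ _≡_ to
    image     : ∀ v → v ∈ vertices ⇔ (∃[ x ] to x ≡ v)
    adjacency : ∀ x y → Adj G x y ⇔ Edge (to x) (to y)

-- Edges are unordered: an edge is coloured through either orientation, and
-- `colour-sym` makes the two agree.
record EdgeColouring (F : Graph) (q : ℕ) : Set where
  field
    colour     : ∀ u v → Adj F u v → Fin q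
    colour-sym : ∀ u v (e : Adj F u v) (e′ : Adj F v u) → colour u v e ≡ colour v u e′

Monochromatic : {F : Graph} {q : ℕ} → EdgeColouring F q → Subgraph F → Set
Monochromatic {q = q} κ S =
  Σ[ c ∈ Fin q ] (∀ u v (e : Edge u v) → colour u v (edge⊆Adj u v e) ≡ c)
  where
  open Subgraph S
  open EdgeColouring κ

infix 4 _⟶⟨_⟩_ _↛⟨_⟩_

-- F ⟶⟨ G ⟩ q is the arrow relation F → (G)_q.
_⟶⟨_⟩_ : Graph → Graph → ℕ → Set
F ⟶⟨ G ⟩ q = (κ : EdgeColouring F q) → Σ[ S ∈ Subgraph F ] (G ≅ S × Monochromatic κ S)

_↛⟨_⟩_ : Graph → Graph → ℕ → Set
F ↛⟨ H ⟩ q = ¬ (F ⟶⟨ H ⟩ q)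

{-# OPTIONS --safe #-}
-- Let r = χ G. It is enough to find F with F → (G)_q all of whose subgraphs on at most |H| vertices
-- are r-colourable, since then F does not even contain H. Such an F comes from iterating the partite
-- construction of Nešetřil and Rödl, starting from a complete graph. Let C be a graph in which every
-- q-colouring of the edges admits a monochromatic homomorphic image of G. Start with disjoint
-- copies of G projecting to C and, for one edge ij of C after the other, amalgamate copies of the
-- current graph along the parts over i and j so that, by Hales–Jewett, some copy has all its edges
-- over ij of one colour. In the end the colour of an edge of some copy of the starting graph depends
-- only on its projection, whence a monochromatic copy of G.
-- If all n-vertex subgraphs of C are r-colourable then all (n+1)-vertex subgraphs of the new graph
-- are: such a subgraph either lies in one amalgamated copy, or meets each copy in at most n
-- vertices; these are coloured through C, with i and j (adjacent in C) receiving prescribed distinct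
-- colours so that the colourings of the copies fit together.
module Submission where

open import Defs
open import Data.Bool.Base using (T; if_then_else_)
open import Data.Bool.Properties using (T?; T-≡; T-irrelevant)
open import Data.Empty using (⊥; ⊥-elim)
open import Data.Fin.Base
  using (Fin; zero; suc; toℕ; _↑ˡ_; _↑ʳ_; join; splitAt; combine; remQuot; finToFun; funToFin)
open import Data.Fin.Permutation using (_⟨$⟩ʳ_; transpose)
open import Data.Fin.Properties as Fin
  using (splitAt-join; remQuot-combine; finToFun-funToFin; pigeonhole; any?; all?; toℕ<n;
         toℕ-injective)
import Data.Fin.Subset as Subset
open import Data.List.Base as List using (List; []; _∷_; length; filter; allFin; cartesianProduct)
open import Data.List.Membership.Propositional using (_∈_)
open import Data.List.Membership.Propositional.Properties
  using (∈-map⁺; ∈-allFin; ∈-filter⁻; ∈-lookup; ∈-filter⁺; ∈-cartesianProduct⁺)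
open import Data.List.Properties using (filter-notAll; length-map; length-tabulate)
open import Data.List.Relation.Binary.Subset.Propositional using (_⊆_)
open import Data.List.Relation.Unary.All as All using (All; []; _∷_)
open import Data.List.Relation.Unary.All.Properties using (¬Any⇒All¬; ¬All⇒Any¬)
open import Data.List.Relation.Unary.AllPairs as AllPairs using (AllPairs; []; _∷_)
import Data.List.Relation.Unary.AllPairs.Properties as AllPairs
open import Data.List.Relation.Unary.Any as Any using (here; there)
open import Data.List.Relation.Unary.Any.Properties using (lookup-index)
open import Data.List.Relation.Unary.Unique.Propositional using (Unique)
open import Data.List.Relation.Unary.Unique.Propositional.Properties using (allFin⁺)
open import Data.Maybe.Base as Maybe using (Maybe; just; nothing; fromMaybe; maybe′)
open import Data.Nat.Base using (ℕ; zero; suc; _+_; _*_; _^_; _≤_; _<_; s≤s; s≤s⁻¹)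
open import Data.Nat.Properties as ℕ
  using (_≤?_; ≰⇒≥; +-cancelˡ-≤; +-monoˡ-≤; ≤-trans; ≤-reflexive; +-suc; n<1+n; ≤∧≢⇒<; <⇒≱; n≤1+n)
open import Data.Product.Base using (Σ-syntax; ∃; ∃-syntax; _×_; _,_; proj₁; proj₂; uncurry)
open import Data.Sum.Base as Sum using (_⊎_; inj₁; inj₂)
open import Data.Vec.Base as Vec using (Vec; []; _∷_; lookup; _++_; tabulate)
open import Data.Vec.Properties
  using (map-++; map-∘; map-cong; map-id; lookup-map; lookup-++ˡ; lookup-++ʳ; lookup∘tabulate;
         lookup⇒[]=; []=⇒lookup)
open import Function.Base using (_∘_; id; const)
open import Function.Bundles using (mk⇔; Equivalence)
open import Function.Definitions using (Injective)
open import Level using (0ℓ)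
open import Relation.Binary.Core using (Rel)
open import Relation.Binary.Definitions
  using (DecidableEquality; Symmetric) renaming (Decidable to Decidable₂)
open import Relation.Binary.PropositionalEquality
  using (_≡_; _≢_; refl; sym; trans; cong; cong₂; subst; subst₂; module ≡-Reasoning)
open import Relation.Nullary using (¬_; Dec; yes; no; contradiction; does)
open import Relation.Nullary.Decidable
  using (map′; ¬?; _×-dec_; ⌊_⌋; toWitness; fromWitness; dec-true; dec-false)
open import Relation.Unary using (Pred; Decidable)

-- Finite types, presented by an enumeration.

record Finite (A : Set) : Set where
  field
    size          : ℕ
    index         : A → Fin size
    element       : Fin size → A
    element-index : ∀ a → element (index a) ≡ a

  index-injective : ∀ {a b} → index a ≡ index b → a ≡ b
  index-injective {a} {b} eq =
    trans (sym (element-index a)) (trans (cong element eq) (element-index b))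

  _≟ᶠ_ : DecidableEquality A
  a ≟ᶠ b = map′ index-injective (cong index) (index a Fin.≟ index b)

  elements : List A
  elements = List.map element (allFin size)

  ∈-elements : ∀ a → a ∈ elements
  ∈-elements a = subst (_∈ elements) (element-index a) (∈-map⁺ element (∈-allFin (index a)))

open Finite

Fin-finite : ∀ n → Finite (Fin n)
Fin-finite n = record
  { size = n ; index = id ; element = id ; element-index = λ _ → refl }

⊎-finite : ∀ {A B} → Finite A → Finite B → Finite (A ⊎ B)
⊎-finite {A} {B} F G = record
  { size = size F + size G ; index = ix ; element = el ∘ splitAt (size F) ; element-index = el-ix }
  where
  ix : A ⊎ B → Fin (size F + size G)
  ix (inj₁ a) = join (size F) (size G) (inj₁ (index F a))
  ix (inj₂ b) = join (size F) (size G) (inj₂ (index G b))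

  el : Fin (size F) ⊎ Fin (size G) → A ⊎ B
  el (inj₁ i) = inj₁ (element F i)
  el (inj₂ j) = inj₂ (element G j)

  el-ix : ∀ x → el (splitAt (size F) (ix x)) ≡ x
  el-ix (inj₁ a) =
    trans (cong el (splitAt-join (size F) (size G) (inj₁ (index F a)))) (cong inj₁ (element-index F a))
  el-ix (inj₂ b) =
    trans (cong el (splitAt-join (size F) (size G) (inj₂ (index G b)))) (cong inj₂ (element-index G b))

×-finite : ∀ {A B} → Finite A → Finite B → Finite (A × B)
×-finite {A} {B} F G = record
  { size          = size F * size G
  ; index         = λ (a , b) → combine (index F a) (index G b)
  ; element       = el ∘ remQuot (size G)
  ; element-index = λ (a , b) →
      trans (cong el (remQuot-combine (index F a) (index G b)))
            (cong₂ _,_ (element-index F a) (element-index G b))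
  }
  where
  el : Fin (size F) × Fin (size G) → A × B
  el (i , j) = element F i , element G j

Maybe-finite : ∀ {A} → Finite A → Finite (Maybe A)
Maybe-finite {A} F = record
  { size = suc (size F) ; index = ix ; element = el ; element-index = el-ix }
  where
  ix : Maybe A → Fin (suc (size F))
  ix nothing  = zero
  ix (just a) = suc (index F a)

  el : Fin (suc (size F)) → Maybe A
  el zero    = nothing
  el (suc i) = just (element F i)

  el-ix : ∀ m → el (ix m) ≡ m
  el-ix nothing  = refl
  el-ix (just a) = cong just (element-index F a)

Vec-finite : ∀ {A} → Finite A → ∀ n → Finite (Vec A n)
Vec-finite F zero = record
  { size = 1 ; index = λ _ → zero ; element = λ _ → [] ; element-index = λ { [] → refl } }
Vec-finite F (suc n) = record
  { size          = size F×Fs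
  ; index         = λ { (x ∷ xs) → index F×Fs (x , xs) }
  ; element       = uncurry _∷_ ∘ element F×Fs
  ; element-index = λ { (x ∷ xs) → cong (uncurry _∷_) (element-index F×Fs (x , xs)) }
  }
  where
  F×Fs = ×-finite F (Vec-finite F n)

code : ∀ {A q} (F : Finite A) → (A → Fin q) → Fin (q ^ size F)
code F f = funToFin (f ∘ element F)

code-injective : ∀ {A q} (F : Finite A) {f g : A → Fin q} → code F f ≡ code F g → ∀ a → f a ≡ g a
code-injective F {f} {g} eq a = begin
  f a                                        ≡⟨ cong f (element-index F a) ⟨
  f (element F (index F a))                  ≡⟨ finToFun-funToFin (f ∘ element F) (index F a) ⟨
  finToFun (code F f) (index F a)            ≡⟨ cong (λ c → finToFun c (index F a)) eq ⟩
  finToFun (code F g) (index F a)            ≡⟨ finToFun-funToFin (g ∘ element F) (index F a) ⟩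
  g (element F (index F a))                  ≡⟨ cong g (element-index F a) ⟩
  g a                                        ∎
  where open ≡-Reasoning

-- Ramsey's theorem for finitely many colours.

AllPairs-lookup : ∀ {A : Set} {R : Rel A 0ℓ} → Symmetric R → ∀ {xs} → AllPairs R xs →
  ∀ {i j} → i ≢ j → R (List.lookup xs i) (List.lookup xs j)
AllPairs-lookup R-sym (_  ∷ _)  {zero}  {zero}  i≢j = contradiction refl i≢j
AllPairs-lookup R-sym (px ∷ _)  {zero}  {suc j} _   = All.lookup px (∈-lookup j)
AllPairs-lookup R-sym (px ∷ _)  {suc i} {zero}  _   = R-sym (All.lookup px (∈-lookup i))
AllPairs-lookup R-sym (_  ∷ ps) {suc i} {suc j} i≢j = AllPairs-lookup R-sym ps (i≢j ∘ cong suc)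

length-filter-∁ : ∀ {A : Set} {P : Pred A 0ℓ} (P? : Decidable P) xs →
  length (filter P? xs) + length (filter (¬? ∘ P?) xs) ≡ length xs
length-filter-∁ P? []       = refl
length-filter-∁ P? (x ∷ xs) with P? x
... | yes _ = cong suc (length-filter-∁ P? xs)
... | no  _ = trans (+-suc _ _) (cong suc (length-filter-∁ P? xs))

+-≤-split : ∀ m {n a b} → m + n ≤ a + b → m ≤ a ⊎ n ≤ b
+-≤-split m {n} {a} {b} le with m ≤? a
... | yes m≤a = inj₁ m≤a
... | no  m≰a = inj₂ (+-cancelˡ-≤ m n b (≤-trans le (+-monoˡ-≤ b (≰⇒≥ m≰a))))

_OfSize_In_ : ∀ {A : Set} → Rel A 0ℓ → ℕ → List A → Set
R OfSize n In xs = ∃[ ys ] length ys ≡ n × AllPairs R ys × ys ⊆ xs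

OfSize-cons : ∀ {A : Set} {S T : Rel A 0ℓ} {P : Pred A 0ℓ} (P? : Decidable P) {n x xs} →
  All (S x) xs → (∀ {y} → S x y → P y → T x y) →
  T OfSize n In filter P? xs → T OfSize suc n In (x ∷ xs)
OfSize-cons P? {x = x} sx⊆ ext (ys , len , pairs , ys⊆) =
  x ∷ ys , cong suc len , All.tabulate related ∷ pairs ,
  λ { (here refl) → here refl ; (there y∈) → there (∈-filter⁻ P? (ys⊆ y∈) .proj₁) }
  where
  related : ∀ {y} → y ∈ ys → _
  related y∈ with y∈xs , Py ← ∈-filter⁻ P? (ys⊆ y∈) = ext (All.lookup sx⊆ y∈xs) Py

OfSize-weaken : ∀ {A : Set} {T : Rel A 0ℓ} {P : Pred A 0ℓ} (P? : Decidable P) {n x xs} →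
  T OfSize n In filter P? xs → T OfSize n In (x ∷ xs)
OfSize-weaken P? (ys , len , pairs , ys⊆) =
  ys , len , pairs , λ y∈ → there (∈-filter⁻ P? (ys⊆ y∈) .proj₁)

-- The usual recursion: the head splits the other elements, at least `M + N` of them, by `R`, and
-- one side is large enough. `S` is carried along so that facts about pairs, such as distinctness,
-- survive the selection.
ramsey₂ : ∀ m n → ∃[ N ] (∀ {A : Set} {S R : Rel A 0ℓ} (R? : Decidable₂ R) xs →
  AllPairs S xs → N ≤ length xs →
  (λ x y → S x y × R x y) OfSize m In xs ⊎ (λ x y → S x y × ¬ R x y) OfSize n In xs)
ramsey₂ zero    _       = 0 , λ _ _ _ _ → inj₁ ([] , refl , [] , λ ())
ramsey₂ (suc m) zero    = 0 , λ _ _ _ _ → inj₂ ([] , refl , [] , λ ())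
ramsey₂ (suc m) (suc n) with ramsey₂ m (suc n) | ramsey₂ (suc m) n
... | M , hypM | N , hypN = suc (M + N) , find
  where
  find : ∀ {A : Set} {S R : Rel A 0ℓ} (R? : Decidable₂ R) xs →
    AllPairs S xs → suc (M + N) ≤ length xs →
    (λ x y → S x y × R x y) OfSize suc m In xs ⊎ (λ x y → S x y × ¬ R x y) OfSize suc n In xs
  find {S = S} R? (x ∷ xs) (sx ∷ ss) (s≤s le)
    with +-≤-split M (≤-trans le (≤-reflexive (sym (length-filter-∁ (R? x) xs))))
  ... | inj₁ M≤ = Sum.map (OfSize-cons {S = S} (R? x) sx _,_) (OfSize-weaken (R? x))
                    (hypM R? (filter (R? x) xs) (AllPairs.filter⁺ (R? x) ss) M≤)
  ... | inj₂ N≤ = Sum.map (OfSize-weaken (¬? ∘ R? x)) (OfSize-cons {S = S} (¬? ∘ R? x) sx _,_)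
                    (hypN R? (filter (¬? ∘ R? x) xs) (AllPairs.filter⁺ (¬? ∘ R? x) ss) N≤)

-- Colours are natural numbers below q, so that the induction on q can split off the top colour.
ramsey : ∀ q r → ∃[ N ] (∀ {A : Set} {S : Rel A 0ℓ} (χ : A → A → ℕ) xs →
  AllPairs (λ x y → S x y × χ x y < q) xs → N ≤ length xs →
  ∃[ c ] (λ x y → S x y × χ x y ≡ c) OfSize r In xs)
-- With no colours left, two elements already contradict the bound on their colour.
ramsey zero    r = 2 , λ { χ (_ ∷ _ ∷ _) (((_ , ()) ∷ _) ∷ _) _ ; χ (_ ∷ []) _ (s≤s ()) }
ramsey (suc q) r with ramsey q r
-- Either `r` elements have the top colour on all pairs, or `M` elements avoid it and the induction
-- applies.
... | M , hyp with ramsey₂ r M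
... | N , split = N , find
  where
  find : ∀ {A : Set} {S : Rel A 0ℓ} (χ : A → A → ℕ) xs →
    AllPairs (λ x y → S x y × χ x y < suc q) xs → N ≤ length xs →
    ∃[ c ] (λ x y → S x y × χ x y ≡ c) OfSize r In xs
  find {S = S} χ xs pairs N≤ with split {S = λ x y → S x y × χ x y < suc q} (λ x y → χ x y ℕ.≟ q) xs pairs N≤
  ... | inj₁ (ys , len , pairs′ , ys⊆) =
    q , ys , len , AllPairs.map (λ ((s , _) , eq) → s , eq) pairs′ , ys⊆
  ... | inj₂ (ys , len , pairs′ , ys⊆)
    with hyp {S = S} χ ys (AllPairs.map (λ ((s , lt) , neq) → s , ≤∧≢⇒< (s≤s⁻¹ lt) neq) pairs′)
           (≤-reflexive (sym len))
  ... | c , zs , len′ , pairs″ , zs⊆ = c , zs , len′ , pairs″ , ys⊆ ∘ zs⊆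

-- The Hales-Jewett theorem.

Word Template : ℕ → ℕ → Set
Word     k d = Vec (Fin k) d
Template k d = Vec (Maybe (Fin k)) d

-- `nothing` marks the moving coordinates of a combinatorial line, all of which receive the same
-- letter.
fill : ∀ {k d} → Template k d → Fin k → Word k d
fill w a = Vec.map (fromMaybe a) w

Active : ∀ {k d} → Template k d → Set
Active w = ∃[ t ] lookup w t ≡ nothing

MonoLine : ∀ {k d} {C : Set} → (Word k d → C) → Set
MonoLine χ = ∃[ w ] Active w × (∀ a b → χ (fill w a) ≡ χ (fill w b))

-- The number of colours is quantified inside because the induction on the alphabet calls the
-- smaller case with many more colours.
HalesJewett : ℕ → Set
HalesJewett k = ∀ q → ∃[ d ] ((χ : Word k d → Fin q) → MonoLine χ)

fill-just : ∀ {k d} (v : Word k d) a → fill (Vec.map just v) a ≡ v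
fill-just v a = trans (sym (map-∘ (fromMaybe a) just v)) (map-id v)

fill-suc : ∀ {k d} (w : Template k d) a →
  fill (Vec.map (Maybe.map suc) w) (suc a) ≡ Vec.map suc (fill w a)
fill-suc w a = begin
  Vec.map (fromMaybe (suc a)) (Vec.map (Maybe.map suc) w) ≡⟨ map-∘ _ _ w ⟨
  Vec.map (fromMaybe (suc a) ∘ Maybe.map suc) w           ≡⟨ map-cong (λ { nothing → refl ; (just _) → refl }) w ⟩
  Vec.map (suc ∘ fromMaybe a) w                           ≡⟨ map-∘ _ _ w ⟩
  Vec.map suc (fill w a)                                  ∎
  where open ≡-Reasoning

active-++ˡ : ∀ {k d d′} (w : Template k d) (w′ : Template k d′) → Active w → Active (w ++ w′)
active-++ˡ {d′ = d′} w w′ (t , eq) = t ↑ˡ d′ , trans (lookup-++ˡ w w′ t) eq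

active-++ʳ : ∀ {k d d′} (w : Template k d) {w′ : Template k d′} → Active w′ → Active (w ++ w′)
active-++ʳ {d = d} w {w′} (t , eq) = d ↑ʳ t , trans (lookup-++ʳ w w′ t) eq

-- The letter `zero` is the one added to the smaller alphabet, which sits inside the larger by
-- `suc`. The colour of the focus itself is left open.
Focused : ∀ {k d q} → (Word (suc k) d → Fin q) → Word (suc k) d → Fin q → Set
Focused χ f γ = ∃[ w ] Active w × fill w zero ≡ f × (∀ a → χ (fill w (suc a)) ≡ γ)

-- Colour focusing: s lines with a common focus and pairwise distinct colours cannot exist for
-- s > q; given s of them, a line of the smaller alphabet in a further block of coordinates
-- produces one more or completes one of them.
module ColourFocusing {k} (hj : HalesJewett (suc k)) (q : ℕ) where

  open import Data.List.Membership.DecPropositional (Fin._≟_ {q}) using (_∈?_)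

  FocusedFamily : ∀ {d} → ℕ → (Word (suc (suc k)) d → Fin q) → Set
  FocusedFamily s χ = ∃[ f ] ∃[ γs ] (length γs ≡ s × Unique γs × All (Focused χ f) γs)

  module Extend {d d′} (χ : Word (suc (suc k)) (d + d′) → Fin q)
    (w′ : Template (suc k) d′) (active : Active w′)
    (same : ∀ u a b → χ (u ++ Vec.map suc (fill w′ a)) ≡ χ (u ++ Vec.map suc (fill w′ b))) where

    w⁺ : Template (suc (suc k)) d′
    w⁺ = Vec.map (Maybe.map suc) w′

    active⁺ : Active w⁺
    active⁺ = active .proj₁ , trans (lookup-map (active .proj₁) _ w′) (cong (Maybe.map suc) (active .proj₂))

    end : Word (suc (suc k)) d′
    end = fill w⁺ (suc zero)

    χ₀ : Word (suc (suc k)) d → Fin q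
    χ₀ u = χ (u ++ end)

    χ-w⁺ : ∀ u a → χ (u ++ fill w⁺ (suc a)) ≡ χ₀ u
    χ-w⁺ u a = begin
      χ (u ++ fill w⁺ (suc a))           ≡⟨ cong (χ ∘ (u ++_)) (fill-suc w′ a) ⟩
      χ (u ++ Vec.map suc (fill w′ a))    ≡⟨ same u a zero ⟩
      χ (u ++ Vec.map suc (fill w′ zero)) ≡⟨ cong (χ ∘ (u ++_)) (fill-suc w′ zero) ⟨
      χ₀ u                                ∎
      where open ≡-Reasoning

    lift-line : MonoLine χ₀ → MonoLine χ
    lift-line (w , act , eq) =
      w ++ Vec.map just end , active-++ˡ w _ act , λ a b → trans (at a) (trans (eq a b) (sym (at b)))
      where
      at : ∀ a → χ (fill (w ++ Vec.map just end) a) ≡ χ₀ (fill w a)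
      at a = cong χ (trans (map-++ (fromMaybe a) w _) (cong (fill w a ++_) (fill-just end a)))

    -- The first block rests at the old focus and only the second moves, so the new line takes the
    -- colour of the old focus.
    focused-point : ∀ f → Focused χ (f ++ fill w⁺ zero) (χ₀ f)
    focused-point f = Vec.map just f ++ w⁺ , active-++ʳ (Vec.map just f) active⁺ , at zero ,
                      λ a → trans (cong χ (at (suc a))) (χ-w⁺ f a)
      where
      at : ∀ a → fill (Vec.map just f ++ w⁺) a ≡ f ++ fill w⁺ a
      at a = trans (map-++ (fromMaybe a) (Vec.map just f) w⁺) (cong (_++ fill w⁺ a) (fill-just f a))

    -- Both blocks move together: at nonzero letters `χ-w⁺` reduces to the old line, and at `zero`
    -- all lines meet in the same point.
    focused-line : ∀ {f γ} → Focused χ₀ f γ → Focused χ (f ++ fill w⁺ zero) γ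
    focused-line (w , act , refl , eq) = w ++ w⁺ , active-++ˡ w w⁺ act , map-++ _ w w⁺ ,
      λ a → trans (cong χ (map-++ _ w w⁺)) (trans (χ-w⁺ _ a) (eq a))

    complete : ∀ {f} → Focused χ₀ f (χ₀ f) → MonoLine χ₀
    complete {f} (w , act , refl , eq) = w , act , λ a b → trans (at a) (sym (at b))
      where
      at : ∀ a → χ₀ (fill w a) ≡ χ₀ f
      at zero    = refl
      at (suc a) = eq a

    extend : ∀ {s} → MonoLine χ₀ ⊎ FocusedFamily s χ₀ → MonoLine χ ⊎ FocusedFamily (suc s) χ
    extend (inj₁ line) = inj₁ (lift-line line)
    extend (inj₂ (f , γs , len , uniq , foc)) with χ₀ f ∈? γs
    ... | yes γ∈ = inj₁ (lift-line (complete (All.lookup foc γ∈)))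
    ... | no  γ∉ = inj₂ (f ++ fill w⁺ zero , χ₀ f ∷ γs , cong suc len , ¬Any⇒All¬ γs γ∉ ∷ uniq ,
                         focused-point f ∷ All.map focused-line foc)

  focus : ∀ s → ∃[ d ] ((χ : Word (suc (suc k)) d → Fin q) → MonoLine χ ⊎ FocusedFamily s χ)
  focus zero = 0 , λ χ → inj₂ ([] , [] , refl , [] , [])
  focus (suc s) with focus s
  -- Words of the second block are coloured by entire functions on the words of the first, hence as
  -- many colours as there are such functions.
  ... | d , lines with hj (q ^ size (Vec-finite (Fin-finite (suc (suc k))) d))
  ... | d′ , line = d + d′ , extend-lines
    where
    words = Vec-finite (Fin-finite (suc (suc k))) d

    extend-lines : (χ : Word (suc (suc k)) (d + d′) → Fin q) → MonoLine χ ⊎ FocusedFamily (suc s) χ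
    extend-lines χ with line (λ v → code words (λ u → χ (u ++ Vec.map suc v)))
    ... | w′ , act , eq = extend (lines χ₀)
      where open Extend χ w′ act (λ u a b → code-injective words (eq a b) u)

  no-family : ∀ {d} (χ : Word (suc (suc k)) d → Fin q) → ¬ FocusedFamily (suc q) χ
  no-family _ (_ , γs , len , uniq , _)
    with i , j , i<j , eq ← pigeonhole (subst (q <_) (sym len) (n<1+n q)) (List.lookup γs) =
    AllPairs-lookup (_∘ sym) uniq (Fin.<⇒≢ i<j) eq

hales-jewett-step : ∀ {k} → HalesJewett (suc k) → HalesJewett (suc (suc k))
hales-jewett-step hj q with ColourFocusing.focus hj q (suc q)
... | d , lines = d , λ χ →
  Sum.fromInj₁ (λ family → contradiction family (ColourFocusing.no-family hj q χ)) (lines χ)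

hales-jewett : ∀ k → HalesJewett k
-- With at most one letter every line is constant; dimension 1 provides the active coordinate.
hales-jewett zero          q = 1 , λ _ → nothing ∷ [] , (zero , refl) , λ ()
hales-jewett (suc zero)    q = 1 , λ _ → nothing ∷ [] , (zero , refl) , λ { zero zero → refl }
hales-jewett (suc (suc k))   = hales-jewett-step (hales-jewett (suc k))

-- Partite graphs over a base graph and their embeddings.

record DecGraph : Set₁ where
  infix 4 _~_
  field
    V        : Set
    finite   : Finite V
    _~_      : V → V → Set
    _~?_     : Decidable₂ _~_
    ~-sym    : Symmetric _~_
    ~-irrefl : ∀ v → ¬ v ~ v

  pairs : List (V × V)
  pairs = cartesianProduct (elements finite) (elements finite)

  ∈-pairs : ∀ u v → (u , v) ∈ pairs
  ∈-pairs u v = ∈-cartesianProduct⁺ (∈-elements finite u) (∈-elements finite v)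

  SymmetricOn : ∀ {q} → (V → V → Fin q) → Set
  SymmetricOn χ = ∀ {u v} → u ~ v → χ u v ≡ χ v u

  ProperOn : ∀ {r} → List V → (V → Fin r) → Set
  ProperOn L c = ∀ {u v} → u ∈ L → v ∈ L → u ~ v → c u ≢ c v

  -- Vertex sets are given as lists, in which repetitions do no harm.
  LocallyColourable : ℕ → ℕ → Set
  LocallyColourable r n = ∀ L → length L ≤ n → ∃[ c ] ProperOn {r} L c

-- The parts are the fibres of π.
record Partite (C : DecGraph) : Set₁ where
  field
    graph : DecGraph
    π     : DecGraph.V graph → DecGraph.V C
    π-~   : ∀ {u v} → DecGraph._~_ graph u v → DecGraph._~_ C (π u) (π v)

  open DecGraph graph public

  ConstantBetween : ∀ {q} → (V → V → Fin q) → DecGraph.V C → DecGraph.V C → Set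
  ConstantBetween χ i j = ∀ {a b a′ b′} → a ~ b → a′ ~ b′ →
    π a ≡ i → π b ≡ j → π a′ ≡ i → π b′ ≡ j → χ a b ≡ χ a′ b′

record Embedding {C} (P Q : Partite C) : Set where
  private
    module P = Partite P
    module Q = Partite Q
  field
    to        : P.V → Q.V
    injective : Injective _≡_ _≡_ to
    to-~      : ∀ {u v} → u P.~ v → to u Q.~ to v
    π-to      : ∀ v → Q.π (to v) ≡ P.π v

open Embedding

Embedding-id : ∀ {C} (P : Partite C) → Embedding P P
Embedding-id P = record { to = id ; injective = id ; to-~ = id ; π-to = λ _ → refl }

infixr 9 _∘ᴱ_
_∘ᴱ_ : ∀ {C} {P Q R : Partite C} → Embedding Q R → Embedding P Q → Embedding P R
g ∘ᴱ f = record
  { to        = to g ∘ to f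
  ; injective = injective f ∘ injective g
  ; to-~      = to-~ g ∘ to-~ f
  ; π-to      = λ v → trans (π-to g (to f v)) (π-to f v)
  }

-- Permuting colours to prescribe two of them.

transposeˡ : ∀ {n} (i j : Fin n) → transpose i j ⟨$⟩ʳ i ≡ j
transposeˡ i j with i Fin.≟ i
... | yes _  = refl
... | no i≢i = contradiction refl i≢i

transpose-≢ : ∀ {n} {i j k : Fin n} → k ≢ i → k ≢ j → transpose i j ⟨$⟩ʳ k ≡ k
transpose-≢ {i = i} {j} {k} k≢i k≢j with k Fin.≟ i
... | yes k≡i = contradiction k≡i k≢i
... | no _ with k Fin.≟ j
...   | yes k≡j = contradiction k≡j k≢j
...   | no _    = refl

transpose-injective : ∀ {n} (i j : Fin n) → Injective _≡_ _≡_ (transpose i j ⟨$⟩ʳ_)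
transpose-injective i j = Injection.injective (↔⇒↣ (transpose i j))
  where open import Function.Properties.Inverse using (↔⇒↣)
        open import Function.Bundles using (Injection)

-- One transposition takes `a` to `α`; the second moves the image of `b` to `β` and fixes `α`, which
-- differs from both.
move-pair : ∀ {r} {a b α β : Fin r} → a ≢ b → α ≢ β →
  ∃[ σ ] (Injective _≡_ _≡_ σ × σ a ≡ α × σ b ≡ β)
move-pair {a = a} {b} {α} {β} a≢b α≢β =
  τ ∘ σ , transpose-injective a α ∘ transpose-injective (σ b) β ,
  trans (cong τ (transposeˡ a α)) (transpose-≢ α≢σb α≢β) , transposeˡ (σ b) β
  where
  σ = transpose a α ⟨$⟩ʳ_
  τ = transpose (σ b) β ⟨$⟩ʳ_

  α≢σb : α ≢ σ b
  α≢σb eq = a≢b (transpose-injective a α (trans (transposeˡ a α) eq))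

module _ (C : DecGraph) where
  open DecGraph C
  open import Data.List.Membership.DecPropositional (_≟ᶠ_ finite) using (_∈?_)

  ProperOn-∘ : ∀ {r} {L} {c : V → Fin r} {σ : Fin r → Fin r} → Injective _≡_ _≡_ σ →
    ProperOn L c → ProperOn L (σ ∘ c)
  ProperOn-∘ inj proper u∈ v∈ u~v = proper u∈ v∈ u~v ∘ inj

  -- If `c i` and `c j` differ, both are moved at once. If they agree, properness forbids both `i`
  -- and `j` in `L`, so one transposition is enough.
  normalised : ∀ {r n} {α β : Fin r} {i j} → LocallyColourable r n → i ~ j → α ≢ β →
    ∀ L → length L ≤ n → ∃[ c ] (ProperOn L c × (i ∈ L → c i ≡ α) × (j ∈ L → c j ≡ β))
  normalised {α = α} {β} {i} {j} local i~j α≢β L L≤ with local L L≤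
  ... | c , proper with c i Fin.≟ c j
  ...   | no ci≢cj with move-pair ci≢cj α≢β
  ...     | σ , inj , σi , σj = σ ∘ c , ProperOn-∘ inj proper , (λ _ → σi) , (λ _ → σj)
  normalised {α = α} {β} {i} {j} local i~j α≢β L L≤ | c , proper | yes ci≡cj with i ∈? L
  ... | yes i∈ = _ , ProperOn-∘ (transpose-injective (c i) α) proper ,
                 (λ _ → transposeˡ (c i) α) , λ j∈ → contradiction ci≡cj (proper i∈ j∈ i~j)
  ... | no i∉  = _ , ProperOn-∘ (transpose-injective (c j) β) proper ,
                 (λ i∈ → contradiction i∈ i∉) , λ _ → transposeˡ (c j) β

-- Amalgamation along two parts.

pattern left  x   = inj₁ x
pattern right y   = inj₂ (inj₁ y)
pattern copy  κ v = inj₂ (inj₂ (κ , v))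

-- One copy of P for every template over the edges between parts i and j, the copies being glued
-- along the powers of these two parts. An index κ also carries a coordinate at which ρ reads off
-- a vertex of the copy; it is only meaningful when active.
module Amalgam {C : DecGraph} (P : Partite C) {i j} (i~j : DecGraph._~_ C i j)
  {k} (ends : Fin k → Partite.V P × Partite.V P)
  (ends-~ : ∀ a → Partite._~_ P (ends a .proj₁) (ends a .proj₂)) (d : ℕ) where

  private
    module C = DecGraph C
  open Partite P

  _≟_ : DecidableEquality C.V
  _≟_ = _≟ᶠ_ C.finite

  i≢j : i ≢ j
  i≢j refl = C.~-irrefl i i~j

  Index : Set
  Index = Template k d × Fin d

  -- The first two summands stand for the powers of the parts over `i` and `j`, enlarged to all
  -- vectors. A `copy κ v` with `v` over `i` or `j` lies in no copy and has no edges.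
  V⁺ : Set
  V⁺ = Vec V d ⊎ Vec V d ⊎ (Index × V)

  V⁺-finite : Finite V⁺
  V⁺-finite = ⊎-finite (Vec-finite finite d) (⊎-finite (Vec-finite finite d)
    (×-finite (×-finite (Vec-finite (Maybe-finite (Fin-finite k)) d) (Fin-finite d)) finite))

  lineˡ lineʳ : Index → V → Vec V d
  lineˡ (w , _) v = Vec.map (maybe′ (proj₁ ∘ ends) v) w
  lineʳ (w , _) v = Vec.map (maybe′ (proj₂ ∘ ends) v) w

  e : Index → V → V⁺
  e κ v with π v ≟ i | π v ≟ j
  ... | yes _ | _     = left (lineˡ κ v)
  ... | no _  | yes _ = right (lineʳ κ v)
  ... | no _  | no _  = copy κ v

  ρ : Index → V⁺ → V
  ρ (_ , t) (left x)   = lookup x t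
  ρ (_ , t) (right y)  = lookup y t
  ρ _       (copy _ v) = v

  π⁺ : V⁺ → C.V
  π⁺ (left _)   = i
  π⁺ (right _)  = j
  π⁺ (copy _ v) = π v

  π⁺-e : ∀ κ v → π⁺ (e κ v) ≡ π v
  π⁺-e κ v with π v ≟ i | π v ≟ j
  ... | yes eq | _      = sym eq
  ... | no _   | yes eq = sym eq
  ... | no _   | no _   = refl

  e-left : ∀ κ {v} → π v ≡ i → e κ v ≡ left (lineˡ κ v)
  e-left κ {v} eq with π v ≟ i
  ... | yes _ = refl
  ... | no neq = contradiction eq neq

  e-right : ∀ κ {v} → π v ≡ j → e κ v ≡ right (lineʳ κ v)
  e-right κ {v} eq with π v ≟ i | π v ≟ j
  ... | yes eq′ | _      = contradiction (trans (sym eq′) eq) i≢j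
  ... | no _    | yes _  = refl
  ... | no _    | no neq = contradiction eq neq

  e≡left : ∀ κ {v x} → e κ v ≡ left x → x ≡ lineˡ κ v
  e≡left κ {v} eq with π v ≟ i | π v ≟ j
  e≡left κ refl | yes _ | _     = refl
  e≡left κ ()   | no _  | yes _
  e≡left κ ()   | no _  | no _

  e≡right : ∀ κ {v y} → e κ v ≡ right y → y ≡ lineʳ κ v
  e≡right κ {v} eq with π v ≟ i | π v ≟ j
  e≡right κ ()   | yes _ | _
  e≡right κ refl | no _  | yes _ = refl
  e≡right κ ()   | no _  | no _

  e≡copy : ∀ κ {κ′ v v′} → e κ v ≡ copy κ′ v′ → κ ≡ κ′
  e≡copy κ {v = v} eq with π v ≟ i | π v ≟ j
  e≡copy κ ()   | yes _ | _
  e≡copy κ ()   | no _  | yes _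
  e≡copy κ refl | no _  | no _ = refl

  ρ-e : ∀ w t → lookup w t ≡ nothing → ∀ v → ρ (w , t) (e (w , t) v) ≡ v
  ρ-e w t eq v with π v ≟ i | π v ≟ j
  ... | yes _ | _     = trans (lookup-map t _ w) (cong (maybe′ _ v) eq)
  ... | no _  | yes _ = trans (lookup-map t _ w) (cong (maybe′ _ v) eq)
  ... | no _  | no _  = refl

  -- Membership in a copy as a decidable equation; for an active coordinate it describes the image
  -- of `e κ`.
  In : Index → V⁺ → Set
  In κ b = e κ (ρ κ b) ≡ b

  In? : ∀ κ b → Dec (In κ b)
  In? κ b = _≟ᶠ_ V⁺-finite (e κ (ρ κ b)) b

  In-copy : ∀ {κ κ′ v} → In κ (copy κ′ v) → κ ≡ κ′
  In-copy {κ} = e≡copy κ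

  π-ρ : ∀ {κ b} → In κ b → π (ρ κ b) ≡ π⁺ b
  π-ρ {κ} {b} b∈ = trans (sym (π⁺-e κ (ρ κ b))) (cong π⁺ b∈)

  Joined : Index → V⁺ → V⁺ → Set
  Joined κ a b = In κ a × In κ b × ρ κ a ~ ρ κ b

  Joined? : ∀ κ a b → Dec (Joined κ a b)
  Joined? κ a b = In? κ a ×-dec In? κ b ×-dec (ρ κ a ~? ρ κ b)

  Joined-sym : ∀ {κ a b} → Joined κ a b → Joined κ b a
  Joined-sym (a∈ , b∈ , a~b) = b∈ , a∈ , ~-sym a~b

  Joined-π⁺ : ∀ {κ a b} → Joined κ a b → π⁺ a C.~ π⁺ b
  Joined-π⁺ (a∈ , b∈ , a~b) = subst₂ C._~_ (π-ρ a∈) (π-ρ b∈) (π-~ a~b)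

  -- Adjacency in every coordinate, so that reading off any single coordinate sends edges between
  -- the powers to edges of `P`.
  Parallel : Vec V d → Vec V d → Set
  Parallel x y = ∀ t → lookup x t ~ lookup y t

  Parallel? : ∀ x y → Dec (Parallel x y)
  Parallel? x y = all? λ t → lookup x t ~? lookup y t

  infix 4 _~⁺_
  _~⁺_ : V⁺ → V⁺ → Set
  left _    ~⁺ left _       = ⊥
  left x    ~⁺ right y      = Parallel x y
  left x    ~⁺ b@(copy κ _) = Joined κ (left x) b
  right y   ~⁺ left x       = Parallel x y
  right _   ~⁺ right _      = ⊥
  right y   ~⁺ b@(copy κ _) = Joined κ (right y) b
  copy κ v  ~⁺ b            = Joined κ (copy κ v) b

  _~⁺?_ : Decidable₂ _~⁺_
  left _    ~⁺? left _       = no id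
  left x    ~⁺? right y      = Parallel? x y
  left x    ~⁺? b@(copy κ _) = Joined? κ (left x) b
  right y   ~⁺? left x       = Parallel? x y
  right _   ~⁺? right _      = no id
  right y   ~⁺? b@(copy κ _) = Joined? κ (right y) b
  copy κ v  ~⁺? b            = Joined? κ (copy κ v) b

  ~⁺-sym : Symmetric _~⁺_
  ~⁺-sym {left _}   {right _}   p = p
  ~⁺-sym {left _}   {copy _ _}  p = Joined-sym p
  ~⁺-sym {right _}  {left _}    p = p
  ~⁺-sym {right _}  {copy _ _}  p = Joined-sym p
  ~⁺-sym {copy _ _} {left _}    p = Joined-sym p
  ~⁺-sym {copy _ _} {right _}   p = Joined-sym p
  ~⁺-sym {copy κ _} {copy κ′ _} p@(_ , b∈ , _) with refl ← In-copy {κ} {κ′} b∈ = Joined-sym p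

  ~⁺-π⁺ : ∀ {a b} → a ~⁺ b → π⁺ a C.~ π⁺ b
  ~⁺-π⁺ {left _}   {right _}  _ = i~j
  ~⁺-π⁺ {left _}   {copy _ _} p = Joined-π⁺ p
  ~⁺-π⁺ {right _}  {left _}   _ = C.~-sym i~j
  ~⁺-π⁺ {right _}  {copy _ _} p = Joined-π⁺ p
  ~⁺-π⁺ {copy _ _} {b}        p = Joined-π⁺ p

  -- The copies of P are induced subgraphs.
  ~⁺-ρ : ∀ {κ a b} → In κ a → In κ b → a ~⁺ b → ρ κ a ~ ρ κ b
  ~⁺-ρ {_ , t} {left _}   {right _}   _ _ p = p t
  ~⁺-ρ {_ , t} {right _}  {left _}    _ _ p = ~-sym (p t)
  ~⁺-ρ {κ} {left _}   {copy κ′ _} _ b∈ (_ , _ , p) with refl ← In-copy {κ} {κ′} b∈ = p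
  ~⁺-ρ {κ} {right _}  {copy κ′ _} _ b∈ (_ , _ , p) with refl ← In-copy {κ} {κ′} b∈ = p
  ~⁺-ρ {κ} {copy κ′ _} {_}        a∈ _ (_ , _ , p) with refl ← In-copy {κ} {κ′} a∈ = p

  lines-parallel : ∀ κ {u v} → u ~ v → Parallel (lineˡ κ u) (lineʳ κ v)
  lines-parallel (w , _) {u} {v} u~v t =
    subst₂ _~_ (sym (lookup-map t _ w)) (sym (lookup-map t _ w)) (pointwise (lookup w t))
    where
    pointwise : ∀ m → maybe′ (proj₁ ∘ ends) u m ~ maybe′ (proj₂ ∘ ends) v m
    pointwise nothing  = u~v
    pointwise (just a) = ends-~ a

  Joined-~⁺ : ∀ {κ a b} → Joined κ a b → a ~⁺ b
  Joined-~⁺ {κ} {left _}  {left _}  p = ⊥-elim (C.~-irrefl i (Joined-π⁺ p))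
  Joined-~⁺ {κ} {left _}  {right _} (a∈ , b∈ , p) =
    subst₂ Parallel (sym (e≡left κ a∈)) (sym (e≡right κ b∈)) (lines-parallel κ p)
  Joined-~⁺ {κ} {right _} {left _}  (a∈ , b∈ , p) =
    subst₂ Parallel (sym (e≡left κ b∈)) (sym (e≡right κ a∈)) (lines-parallel κ (~-sym p))
  Joined-~⁺ {κ} {right _} {right _} p = ⊥-elim (C.~-irrefl j (Joined-π⁺ p))
  Joined-~⁺ {κ} {left _}  {copy κ′ _}  p@(_ , b∈ , _) with refl ← In-copy {κ} {κ′} b∈ = p
  Joined-~⁺ {κ} {right _} {copy κ′ _}  p@(_ , b∈ , _) with refl ← In-copy {κ} {κ′} b∈ = p
  Joined-~⁺ {κ} {copy κ′ _} {_} p@(a∈ , _ , _) with refl ← In-copy {κ} {κ′} a∈ = p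

  amalgam : Partite C
  amalgam = record
    { graph = record
      { V        = V⁺
      ; finite   = V⁺-finite
      ; _~_      = _~⁺_
      ; _~?_     = _~⁺?_
      ; ~-sym    = λ {a} {b} → ~⁺-sym {a} {b}
      ; ~-irrefl = λ a a~a → C.~-irrefl (π⁺ a) (~⁺-π⁺ {a} {a} a~a)
      }
    ; π   = π⁺
    ; π-~ = λ {a} {b} → ~⁺-π⁺ {a} {b}
    }

  embed : ∀ w t → lookup w t ≡ nothing → Embedding P amalgam
  embed w t eq = record
    { to        = e κ
    ; injective = λ {u} {v} same → trans (sym (ρe u)) (trans (cong (ρ κ) same) (ρe v))
    ; to-~      = λ {u} {v} u~v → Joined-~⁺ {κ} {e κ u} {e κ v}
        (cong (e κ) (ρe u) , cong (e κ) (ρe v) , subst₂ _~_ (sym (ρe u)) (sym (ρe v)) u~v)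
    ; π-to      = π⁺-e κ
    }
    where
    κ = w , t
    ρe = ρ-e w t eq

  endsˡ endsʳ : Word k d → Vec V d
  endsˡ = Vec.map (proj₁ ∘ ends)
  endsʳ = Vec.map (proj₂ ∘ ends)

  -- If the moving vertex is itself an end of the edge with letter `a`, the point on the line is
  -- given by the word `fill w a`.
  map-fill : ∀ (g : Fin k → V) a (w : Template k d) → Vec.map (maybe′ g (g a)) w ≡ Vec.map g (fill w a)
  map-fill g a w = trans (map-cong (λ { nothing → refl ; (just _) → refl }) w) (map-∘ g (fromMaybe a) w)

  module _ {q} (χ : V⁺ → V⁺ → Fin q) (w : Template k d) (t : Fin d)
    (letter : ∀ {x y} → x ~ y → π x ≡ i → π y ≡ j → ∃[ a ] (x , y) ≡ ends a)
    (mono : ∀ a b → χ (left (endsˡ (fill w a))) (right (endsʳ (fill w a))) ≡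
                    χ (left (endsˡ (fill w b))) (right (endsʳ (fill w b)))) where

    private
      κ : Index
      κ = w , t

    colour-of-edge : ∀ {x y} → π x ≡ i → π y ≡ j → ∀ a → (x , y) ≡ ends a →
      χ (e κ x) (e κ y) ≡ χ (left (endsˡ (fill w a))) (right (endsʳ (fill w a)))
    colour-of-edge πx πy a eq = cong₂ χ
      (trans (e-left κ πx) (cong left (trans (cong (lineˡ κ) (cong proj₁ eq)) (map-fill _ a w))))
      (trans (e-right κ πy) (cong right (trans (cong (lineʳ κ) (cong proj₂ eq)) (map-fill _ a w))))

    -- Every edge of `P` over `i` and `j` is a letter, so the embedding sends it to a point of the
    -- combinatorial line `w`, along which `χ` is constant by `mono`.
    embed-constant : ConstantBetween (λ x y → χ (e κ x) (e κ y)) i j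
    embed-constant x~y x′~y′ πx πy πx′ πy′ =
      let a , eq  = letter x~y πx πy
          b , eq′ = letter x′~y′ πx′ πy′
      in trans (colour-of-edge πx πy a eq) (trans (mono a b) (sym (colour-of-edge πx′ πy′ b eq′)))

  module _ {r n} {α β : Fin r} (α≢β : α ≢ β)
    (C-local : C.LocallyColourable r n) (P-local : LocallyColourable r (suc n)) where

    open DecGraph (Partite.graph amalgam) using ()
      renaming (ProperOn to ProperOn⁺; LocallyColourable to LocallyColourable⁺)

    -- The copy is induced, so `ρ κ` maps `L` to `P` preserving edges and a colouring pulls back.
    inside-copy : ∀ κ L → length L ≤ suc n → All (In κ) L → ∃[ c ] ProperOn⁺ {r} L c
    inside-copy κ L L≤ L⊆κ with P-local (List.map (ρ κ) L) (≤-trans (≤-reflexive (length-map (ρ κ) L)) L≤)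
    ... | c , proper = c ∘ ρ κ , λ {a} {b} a∈ b∈ a~b →
      proper (∈-map⁺ (ρ κ) a∈) (∈-map⁺ (ρ κ) b∈)
        (~⁺-ρ {κ} {a} {b} (All.lookup L⊆κ a∈) (All.lookup L⊆κ b∈) a~b)

    -- Each copy contains too few members of L to need P-local, so it is coloured through π⁺; since
    -- parts i and j always get the colours α and β, these colourings agree where copies are glued.
    across-copies : ∀ L → length L ≤ suc n → (∀ κ → ¬ All (In κ) L) → ∃[ c ] ProperOn⁺ {r} L c
    across-copies L L≤ L⊈ = c , λ {a} {b} → proper {a} {b}
      where
      L[_] : Index → List C.V
      L[ κ ] = List.map π⁺ (filter (In? κ) L)

      L[_]-short : ∀ κ → length L[ κ ] ≤ n
      L[ κ ]-short = s≤s⁻¹ (≤-trans (≤-trans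
        (s≤s (≤-reflexive (length-map π⁺ (filter (In? κ) L))))
        (filter-notAll (In? κ) L (¬All⇒Any¬ (In? κ) L (L⊈ κ)))) L≤)

      colouring : ∀ κ → ∃[ c ] (C.ProperOn L[ κ ] c × (i ∈ L[ κ ] → c i ≡ α) × (j ∈ L[ κ ] → c j ≡ β))
      colouring κ = normalised C C-local i~j α≢β L[ κ ] L[ κ ]-short

      c : V⁺ → Fin r
      c (left _)   = α
      c (right _)  = β
      c (copy κ v) = colouring κ .proj₁ (π v)

      ∈L[_] : ∀ κ {a} → a ∈ L → In κ a → π⁺ a ∈ L[ κ ]
      ∈L[ κ ] a∈ a∈κ = ∈-map⁺ π⁺ (∈-filter⁺ (In? κ) a∈ a∈κ)

      c-via-π⁺ : ∀ κ a → a ∈ L → In κ a → c a ≡ colouring κ .proj₁ (π⁺ a)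
      c-via-π⁺ κ (left _)    a∈ a∈κ = sym (colouring κ .proj₂ .proj₂ .proj₁ (∈L[ κ ] a∈ a∈κ))
      c-via-π⁺ κ (right _)   a∈ a∈κ = sym (colouring κ .proj₂ .proj₂ .proj₂ (∈L[ κ ] a∈ a∈κ))
      c-via-π⁺ κ (copy κ′ v) a∈ a∈κ = cong (λ κ″ → colouring κ″ .proj₁ (π v)) (sym (In-copy {κ} {κ′} a∈κ))

      Joined-proper : ∀ {κ a b} → a ∈ L → b ∈ L → Joined κ a b → c a ≢ c b
      Joined-proper {κ} {a} {b} a∈ b∈ p@(a∈κ , b∈κ , _) eq =
        colouring κ .proj₂ .proj₁ (∈L[ κ ] a∈ a∈κ) (∈L[ κ ] b∈ b∈κ) (Joined-π⁺ p)
          (trans (sym (c-via-π⁺ κ a a∈ a∈κ)) (trans eq (c-via-π⁺ κ b b∈ b∈κ)))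

      proper : ProperOn⁺ L c
      proper {left _}   {right _}  _  _  _ = α≢β
      proper {left _}   {copy _ _} a∈ b∈ p = Joined-proper a∈ b∈ p
      proper {right _}  {left _}   _  _  _ = α≢β ∘ sym
      proper {right _}  {copy _ _} a∈ b∈ p = Joined-proper a∈ b∈ p
      proper {copy _ _} {_}        a∈ b∈ p = Joined-proper a∈ b∈ p

    HasCopy : List V⁺ → Set
    HasCopy L = Σ[ κ ∈ Index ] Σ[ v ∈ V ] copy κ v ∈ L

    hasCopy? : ∀ L → Dec (HasCopy L)
    hasCopy? []             = no λ ()
    hasCopy? (copy κ v ∷ L) = yes (κ , v , here refl)
    hasCopy? (left _ ∷ L)   =
      map′ (λ (κ , v , v∈) → κ , v , there v∈) (λ { (κ , v , there v∈) → κ , v , v∈ }) (hasCopy? L)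
    hasCopy? (right _ ∷ L)  =
      map′ (λ (κ , v , v∈) → κ , v , there v∈) (λ { (κ , v , there v∈) → κ , v , v∈ }) (hasCopy? L)

    -- Only the two powers are met, and they span a bipartite graph; the value on `copy` is a
    -- filler.
    without-copies : ∀ L → ¬ HasCopy L → ∃[ c ] ProperOn⁺ {r} L c
    without-copies L none = c , λ {a} {b} → proper {a} {b}
      where
      c : V⁺ → Fin r
      c (left _)   = α
      c (right _)  = β
      c (copy _ _) = α

      proper : ProperOn⁺ L c
      proper {left _}   {right _}  _  _  _ = α≢β
      proper {left _}   {copy _ _} _  b∈ _ = contradiction (_ , _ , b∈) none
      proper {right _}  {left _}   _  _  _ = α≢β ∘ sym
      proper {right _}  {copy _ _} _  b∈ _ = contradiction (_ , _ , b∈) none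
      proper {copy _ _} {_}        a∈ _  _ = contradiction (_ , _ , a∈) none

    -- A private vertex of copy `κ` lies in no other copy, so testing `κ` alone decides whether any
    -- copy contains `L`.
    amalgam-local : LocallyColourable⁺ r (suc n)
    amalgam-local L L≤ with hasCopy? L
    ... | no none = without-copies L none
    ... | yes (κ , v , v∈) with All.all? (In? κ) L
    ...   | yes L⊆κ = inside-copy κ L L≤ L⊆κ
    ...   | no  L⊈κ = across-copies L L≤ λ κ′ L⊆κ′ →
      L⊈κ (subst (λ κ″ → All (In κ″) L) (In-copy {κ′} {κ} (All.lookup L⊆κ′ v∈)) L⊆κ′)

-- Amalgamating over one pair of parts after another.

ConstantPullback : ∀ {C q} {P Q : Partite C} → (Partite.V Q → Partite.V Q → Fin q) → Embedding P Q →
  DecGraph.V C → DecGraph.V C → Set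
ConstantPullback {P = P} χ f = Partite.ConstantBetween P (λ a b → χ (to f a) (to f b))

record Refinement {C} (P : Partite C) (r n q : ℕ) (D : List (DecGraph.V C × DecGraph.V C)) : Set₁ where
  field
    partite : Partite C
    local   : Partite.LocallyColourable partite r n
    find    : (χ : Partite.V partite → Partite.V partite → Fin q) →
              Σ[ f ∈ Embedding P partite ] (∀ {i j} → (i , j) ∈ D → ConstantPullback χ f i j)

module _ {C : DecGraph} {r n} {α β : Fin r} (α≢β : α ≢ β)
  (C-local : DecGraph.LocallyColourable C r n) (q : ℕ) where

  private
    module C = DecGraph C
    _≟_ : DecidableEquality C.V
    _≟_ = _≟ᶠ_ C.finite

  step : (P : Partite C) → Partite.LocallyColourable P r (suc n) → ∀ {i j} → i C.~ j →
    Refinement P r (suc n) q ((i , j) ∷ [])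
  step P P-local {i} {j} i~j = record
    { partite = amalgam
    ; local   = amalgam-local α≢β C-local P-local
    ; find    = find
    }
    where
    open Partite P

    Edge? : ∀ (xy : V × V) → Dec (π (xy .proj₁) ≡ i × π (xy .proj₂) ≡ j × xy .proj₁ ~ xy .proj₂)
    Edge? (x , y) = π x ≟ i ×-dec π y ≟ j ×-dec x ~? y

    edges : List (V × V)
    edges = filter Edge? pairs

    ends : Fin (length edges) → V × V
    ends = List.lookup edges

    ends-edge : ∀ a → _
    ends-edge a = ∈-filter⁻ Edge? {xs = pairs} (∈-lookup a) .proj₂

    edge-letter : ∀ {x y} → x ~ y → π x ≡ i → π y ≡ j → ∃[ a ] (x , y) ≡ ends a
    edge-letter {x} {y} x~y πx πy = Any.index xy∈ , lookup-index xy∈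
      where
      xy∈ : (x , y) ∈ edges
      xy∈ = ∈-filter⁺ Edge? (∈-pairs x y) (πx , πy , x~y)

    hj = hales-jewett (length edges) q
    open Amalgam P i~j ends (λ a → ends-edge a .proj₂ .proj₂) (hj .proj₁)

    find : (χ : V⁺ → V⁺ → Fin q) →
      Σ[ f ∈ Embedding P amalgam ] (∀ {i′ j′} → (i′ , j′) ∈ (i , j) ∷ [] → ConstantPullback χ f i′ j′)
    find χ =
      -- A word over the edges is coloured like the edge joining its vector of left ends to its
      -- vector of right ends.
      let w , (t , active) , mono = hj .proj₂ (λ v → χ (left (endsˡ v)) (right (endsʳ v)))
      in embed w t active , λ { (here refl) → embed-constant χ w t edge-letter mono }

  -- The head pair is amalgamated last. For a given colouring its copy `g` is found first and `f`
  -- inside it, so constancy over the head pair passes to `g ∘ᴱ f`.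
  refine : (P : Partite C) → Partite.LocallyColourable P r (suc n) → ∀ D → Refinement P r (suc n) q D
  refine P P-local [] = record { partite = P ; local = P-local ; find = λ _ → Embedding-id P , λ () }
  refine P P-local ((i , j) ∷ D) with refine P P-local D | i C.~? j
  ... | R | no i≁j = record
    { partite = partite
    ; local   = local
    ; find    = λ χ → find χ .proj₁ , λ where
        (here refl) a~b _ πa πb _ _ → ⊥-elim (i≁j (subst₂ C._~_ πa πb (Partite.π-~ P a~b)))
        (there ij∈) → find χ .proj₂ ij∈
    }
    where open Refinement R
  ... | R | yes i~j = record
    { partite = S.partite
    ; local   = S.local
    ; find    = find
    }
    where
    module R = Refinement R
    module S = Refinement (step R.partite R.local i~j)

    find : (χ : Partite.V S.partite → Partite.V S.partite → Fin q) →
      Σ[ f ∈ Embedding P S.partite ] (∀ {i′ j′} → (i′ , j′) ∈ (i , j) ∷ D → ConstantPullback χ f i′ j′)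
    find χ with S.find χ
    ... | g , g-const with R.find (λ a b → χ (to g a) (to g b))
    ... | f , f-const = g ∘ᴱ f , λ where
      (here refl) a~b a′~b′ πa πb πa′ πb′ → g-const (here refl) (to-~ f a~b) (to-~ f a′~b′)
        (trans (π-to f _) πa) (trans (π-to f _) πb) (trans (π-to f _) πa′) (trans (π-to f _) πb′)
      (there ij∈) → f-const ij∈

-- The arrow property and its transfer from the base graph.

module _ (G : Graph) {r} (c₀ : Vertex G → Fin r) (c₀-proper : Proper G c₀)
  {x₀ y₀ : Vertex G} (x₀y₀ : Adj G x₀ y₀) (q : ℕ) where

  open Graph G using (order; adj-sym; adj-irrefl)

  module _ (C : DecGraph) where
    open DecGraph C

    MonoHom : (V → V → Fin q) → (Vertex G → V) → Set
    MonoHom χ h = ∃[ c ] (∀ {x y} → Adj G x y → h x ~ h y × χ (h x) (h y) ≡ c)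

    -- Homomorphic images are all that is asked of a base graph; injectivity comes from the
    -- construction over it.
    HomArrows EmbeddingArrows : Set
    HomArrows       = ∀ χ → SymmetricOn χ → ∃ (MonoHom χ)
    EmbeddingArrows = ∀ χ → SymmetricOn χ → ∃[ h ] (Injective _≡_ _≡_ h × MonoHom χ h)

  complete : ℕ → DecGraph
  complete N = record
    { V        = Fin N
    ; finite   = Fin-finite N
    ; _~_      = _≢_
    ; _~?_     = λ u v → ¬? (u Fin.≟ v)
    ; ~-sym    = _∘ sym
    ; ~-irrefl = λ _ v≢v → v≢v refl
    }

  -- A monochromatic clique on `r` vertices receives `G` through its colouring `c₀`.
  complete-arrows : ∃[ N ] HomArrows (complete N)
  complete-arrows with ramsey q r
  ... | N , hyp = N , arrows
    where
    arrows : HomArrows (complete N)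
    arrows χ χ-sym with hyp {S = _≢_} (λ u v → toℕ (χ u v)) (allFin N)
      (AllPairs.map (λ u≢v → u≢v , toℕ<n _) (allFin⁺ N)) (≤-reflexive (sym (length-tabulate id)))
    -- Ramsey returns a natural number as colour; the colour in `Fin q` is read off at the edge
    -- `x₀ y₀`.
    ... | c , ys , refl , pairs , _ = h , χ (h x₀) (h y₀) , λ xy →
      h-pair xy .proj₁ , toℕ-injective (trans (h-pair xy .proj₂) (sym (h-pair x₀y₀ .proj₂)))
      where
      h : Vertex G → Fin N
      h = List.lookup ys ∘ c₀

      h-pair : ∀ {x y} → Adj G x y → h x ≢ h y × toℕ (χ (h x) (h y)) ≡ c
      h-pair xy = AllPairs-lookup
        (λ (u≢v , eq) → u≢v ∘ sym , trans (cong toℕ (sym (χ-sym u≢v))) eq) pairs (c₀-proper _ _ xy)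

  -- The maps h from G to C are arbitrary; the edges of G which h does not preserve are left out.
  transversals : (C : DecGraph) → Partite C
  transversals C = record
    { graph = record
      { V        = Vec V order × Vertex G
      ; finite   = ×-finite (Vec-finite finite order) (Fin-finite order)
      ; _~_      = λ (h , x) (h′ , y) → h ≡ h′ × Adj G x y × lookup h x ~ lookup h′ y
      ; _~?_     = λ (h , x) (h′ , y) →
          _≟ᶠ_ (Vec-finite finite order) h h′ ×-dec T? _ ×-dec (lookup h x ~? lookup h′ y)
      ; ~-sym    = λ (h≡h′ , xy , hx~hy) → sym h≡h′ , adj-sym _ _ xy , ~-sym hx~hy
      ; ~-irrefl = λ (_ , x) (_ , xx , _) → adj-irrefl x xx
      }
    ; π   = λ (h , x) → lookup h x
    ; π-~ = λ (_ , _ , hx~hy) → hx~hy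
    }
    where open DecGraph C

  transversals-local : ∀ C n → Partite.LocallyColourable (transversals C) r n
  transversals-local C n L _ = c₀ ∘ proj₂ , λ _ _ (_ , xy , _) → c₀-proper _ _ xy

  module _ {C n} (C-arrows : HomArrows C)
    (R : Refinement (transversals C) r n q (DecGraph.pairs C)) where

    open DecGraph C
    open Refinement R

    private
      P₀ = transversals C
      module P₀ = Partite P₀

    -- A transversal under which the edge `x₀ y₀` lies over the pair `i`, `j`; it tests the colour
    -- over that pair.
    spread : V → V → Vec V order
    spread i j = tabulate λ x → if does (x Fin.≟ x₀) then i else j

    spread-x₀ : ∀ i j → lookup (spread i j) x₀ ≡ i
    spread-x₀ i j = trans (lookup∘tabulate _ x₀)
      (cong (if_then i else j) (dec-true (x₀ Fin.≟ x₀) refl))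

    spread-y₀ : ∀ i j → lookup (spread i j) y₀ ≡ j
    spread-y₀ i j = trans (lookup∘tabulate _ y₀)
      (cong (if_then i else j) (dec-false (y₀ Fin.≟ x₀) λ { refl → adj-irrefl x₀ x₀y₀ }))

    -- In the copy found, colours depend only on projections, so `ψ` is a colouring of `C`. The copy
    -- of `G` indexed by a map `h` monochromatic for `ψ` is then monochromatic for `χ`.
    refinement-arrows : EmbeddingArrows (Partite.graph partite)
    refinement-arrows χ χ-sym with find χ
    ... | f , f-const = transfer (C-arrows ψ ψ-sym)
      where
      χ′ : P₀.V → P₀.V → Fin q
      χ′ a b = χ (to f a) (to f b)

      constant : ∀ i j → P₀.ConstantBetween χ′ i j
      constant i j = f-const (∈-pairs i j)

      ψ : V → V → Fin q
      ψ i j = χ′ (spread i j , x₀) (spread i j , y₀)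

      spread-~ : ∀ {i j} → i ~ j → (spread i j , x₀) P₀.~ (spread i j , y₀)
      spread-~ {i} {j} i~j = refl , x₀y₀ , subst₂ _~_ (sym (spread-x₀ i j)) (sym (spread-y₀ i j)) i~j

      ψ-sym : SymmetricOn ψ
      -- The reversed test edge for `i j` and the test edge for `j i` lie over the same pair.
      ψ-sym {i} {j} i~j = trans (χ-sym (to-~ f (spread-~ i~j)))
        (constant j i (P₀.~-sym (spread-~ i~j)) (spread-~ (~-sym i~j))
          (spread-y₀ i j) (spread-x₀ i j) (spread-x₀ j i) (spread-y₀ j i))

      transfer : ∃ (MonoHom C ψ) → ∃[ g ] (Injective _≡_ _≡_ g × MonoHom (Partite.graph partite) χ g)
      transfer (h , c , mono) = to f ∘ section , (λ eq → cong proj₂ (injective f eq)) , c , λ xy →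
        to-~ f (section-~ xy) ,
        trans (constant (h _) (h _) (section-~ xy) (spread-~ (mono xy .proj₁))
                 (lookup∘tabulate h _) (lookup∘tabulate h _) (spread-x₀ _ _) (spread-y₀ _ _))
              (mono xy .proj₂)
        where
        section : Vertex G → P₀.V
        section x = tabulate h , x

        section-~ : ∀ {x y} → Adj G x y → section x P₀.~ section y
        section-~ xy = refl , xy ,
          subst₂ _~_ (sym (lookup∘tabulate h _)) (sym (lookup∘tabulate h _)) (mono xy .proj₁)

  sparser : ∀ {C n} → DecGraph.LocallyColourable C r n → HomArrows C →
    ∃[ D ] (DecGraph.LocallyColourable D r (suc n) × EmbeddingArrows D)
  sparser {C} {n} C-local C-arrows = Partite.graph partite , local , refinement-arrows C-arrows R
    where
    -- The ends of an edge of `G` supply the two distinct colours prescribed in the amalgamation.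
    R = refine (c₀-proper x₀ y₀ x₀y₀) C-local q (transversals C) (transversals-local C (suc n)) _
    open Refinement R

  sparse : ∀ n → ∃[ C ] (DecGraph.LocallyColourable C r n × HomArrows C)
  sparse zero =
    let N , arrows = complete-arrows
    -- Only the empty list has to be coloured, but a total function still needs some colour.
    in complete N , (λ { [] _ → const (c₀ x₀) , λ () }) , arrows
  sparse (suc n) =
    let C , local  , arrows  = sparse n
        D , local′ , arrows′ = sparser {C} local arrows
    in D , local′ , λ χ χ-sym → let h , _ , mono = arrows′ χ χ-sym in h , mono

  -- A final round replaces homomorphic images by embeddings.
  sparse-embedding : ∀ n → ∃[ C ] (DecGraph.LocallyColourable C r (suc n) × EmbeddingArrows C)
  sparse-embedding n = let C , local , arrows = sparse n in sparser {C} local arrows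

-- Back to graphs on `Fin` and colourings of edges.

toGraph : DecGraph → Graph
toGraph C = record
  { order      = size finite
  ; adj        = λ u v → ⌊ element finite u ~? element finite v ⌋
  ; adj-sym    = λ u v uv → fromWitness (~-sym (toWitness uv))
  ; adj-irrefl = λ v vv → ~-irrefl _ (toWitness vv)
  }
  where open DecGraph C

image-subgraph : (F G : Graph) (h : Vertex G → Vertex F) → Injective _≡_ _≡_ h →
  (∀ x y → Adj G x y → Adj F (h x) (h y)) →
  Σ[ S ∈ Subgraph F ] (G ≅ S ×
    (∀ u v → Subgraph.Edge S u v → ∃[ x ] ∃[ y ] (h x ≡ u × h y ≡ v × Adj G x y)))
image-subgraph F G h inj hom = S , iso , λ _ _ → toWitness
  where
  Preimage : Vertex F → Vertex F → Set
  Preimage u v = ∃[ x ] ∃[ y ] (h x ≡ u × h y ≡ v × Adj G x y)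

  preimage? : ∀ u v → Dec (Preimage u v)
  preimage? u v = any? λ x → any? λ y → h x Fin.≟ u ×-dec h y Fin.≟ v ×-dec T? (Graph.adj G x y)

  inImage? : ∀ v → Dec (∃[ x ] h x ≡ v)
  inImage? v = any? λ x → h x Fin.≟ v

  vertices : Subset.Subset (Graph.order F)
  vertices = tabulate λ v → ⌊ inImage? v ⌋

  ∈-vertices : ∀ {v} → (∃[ x ] h x ≡ v) → v Subset.∈ vertices
  ∈-vertices {v} x = lookup⇒[]= v vertices
    (trans (lookup∘tabulate _ v) (Equivalence.to T-≡ (fromWitness {a? = inImage? v} x)))

  vertices-∈ : ∀ {v} → v Subset.∈ vertices → ∃[ x ] h x ≡ v
  vertices-∈ {v} v∈ = toWitness {a? = inImage? v}
    (Equivalence.from T-≡ (trans (sym (lookup∘tabulate _ v)) ([]=⇒lookup v∈)))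

  S : Subgraph F
  S = record
    { vertices  = vertices
    ; edge      = λ u v → ⌊ preimage? u v ⌋
    ; edge-sym  = λ u v uv → let x , y , hx , hy , xy = toWitness {a? = preimage? u v} uv in
                             fromWitness (y , x , hy , hx , Graph.adj-sym G x y xy)
    ; edge-ends = λ u v uv → let x , y , hx , hy , _ = toWitness {a? = preimage? u v} uv in
                             ∈-vertices (x , hx) , ∈-vertices (y , hy)
    ; edge⊆Adj  = λ u v uv → let x , y , hx , hy , xy = toWitness {a? = preimage? u v} uv in
                             subst₂ (Adj F) hx hy (hom x y xy)
    }

  iso : G ≅ S
  iso = record
    { to        = h
    ; injective = inj
    ; image     = λ v → mk⇔ vertices-∈ ∈-vertices
    ; adjacency = λ x y → mk⇔ (λ xy → fromWitness (x , y , refl , refl , xy)) λ e →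
        let x′ , y′ , hx , hy , xy = toWitness {a? = preimage? (h x) (h y)} e in
        subst₂ (Adj G) (inj hx) (inj hy) xy
    }

monochromatic-image : ∀ (F G : Graph) {q} (κ : EdgeColouring F q) (h : Vertex G → Vertex F) →
  Injective _≡_ _≡_ h →
  (c : Fin q) → (∀ x y → Adj G x y → Σ[ e ∈ Adj F (h x) (h y) ] EdgeColouring.colour κ (h x) (h y) e ≡ c) →
  Σ[ S ∈ Subgraph F ] (G ≅ S × Monochromatic κ S)
monochromatic-image F G κ h inj c mono
  with S , iso , pre ← image-subgraph F G h inj (λ x y xy → mono x y xy .proj₁) =
  S , iso , c , λ u v e → colour-pre u v (Subgraph.edge⊆Adj S u v e) (pre u v e)
  where
  colour-pre : ∀ u v (e : Adj F u v) → ∃[ x ] ∃[ y ] (h x ≡ u × h y ≡ v × Adj G x y) →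
    EdgeColouring.colour κ u v e ≡ c
  colour-pre u v e (x , y , refl , refl , xy) with e′ , eq ← mono x y xy =
    trans (cong (EdgeColouring.colour κ u v) (T-irrelevant e e′)) eq

-- Edge colourings of `toGraph C` are given only on edges; a default colour extends them to all
-- pairs of vertices.
module TotalColouring (C : DecGraph) {q} (default : Fin q) (κ : EdgeColouring (toGraph C) q) where
  open DecGraph C
  open EdgeColouring κ

  private
    F = toGraph C

  colourIf : ∀ {u v} → Dec (Adj F u v) → Fin q
  colourIf (yes uv) = colour _ _ uv
  colourIf (no _)   = default

  colourIf-sym : ∀ {u v} (uv? : Dec (Adj F u v)) (vu? : Dec (Adj F v u)) → colourIf uv? ≡ colourIf vu?
  colourIf-sym (yes uv) (yes vu) = colour-sym _ _ uv vu
  colourIf-sym (yes uv) (no ¬vu) = contradiction (Graph.adj-sym F _ _ uv) ¬vu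
  colourIf-sym (no ¬uv) (yes vu) = contradiction (Graph.adj-sym F _ _ vu) ¬uv
  colourIf-sym (no _)   (no _)   = refl

  colourIf-yes : ∀ {u v} (uv? : Dec (Adj F u v)) (uv : Adj F u v) → colourIf uv? ≡ colour u v uv
  colourIf-yes (yes uv′) uv = cong (colour _ _) (T-irrelevant uv′ uv)
  colourIf-yes (no ¬uv)  uv = contradiction uv ¬uv

  adj? : ∀ u v → Dec (Adj F u v)
  adj? u v = T? (Graph.adj F u v)

  total : V → V → Fin q
  total a b = colourIf (adj? (index finite a) (index finite b))

  total-sym : ∀ a b → total a b ≡ total b a
  total-sym a b = colourIf-sym (adj? _ _) (adj? _ _)

  total-edge : ∀ {a b} → a ~ b →
    Σ[ e ∈ Adj F (index finite a) (index finite b) ] colour (index finite a) (index finite b) e ≡ total a b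
  total-edge a~b = e , sym (colourIf-yes (adj? _ _) e)
    where e = fromWitness (subst₂ _~_ (sym (element-index finite _)) (sym (element-index finite _)) a~b)

toGraph-arrows : ∀ (G : Graph) {r} (c₀ : Vertex G → Fin r) (c₀-proper : Proper G c₀)
  {x₀ y₀ : Vertex G} (x₀y₀ : Adj G x₀ y₀) {q} → Fin q → ∀ C →
  EmbeddingArrows G c₀ c₀-proper x₀y₀ q C → toGraph C ⟶⟨ G ⟩ q
toGraph-arrows G c₀ c₀-proper x₀y₀ default C arrows κ
  with h , inj , c , mono ←
    arrows (TotalColouring.total C default κ) (λ _ → TotalColouring.total-sym C default κ _ _) =
  monochromatic-image (toGraph C) G κ (index finite ∘ h) (inj ∘ index-injective finite) c λ x y xy →
    let hx~hy , eq = mono xy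
        e , eq′    = TotalColouring.total-edge C default κ hx~hy
    in e , trans eq′ eq
  where open DecGraph C

-- The constant colouring suffices: a copy of `H` is in particular a homomorphism, so `H` would be
-- `r`-colourable.
no-homs⇒↛ : ∀ {F H : Graph} {r q} → r < χ H → Fin q →
  (∀ (h : Vertex H → Vertex F) → (∀ x y → Adj H x y → Adj F (h x) (h y)) → Colourable H r) → F ↛⟨ H ⟩ q
no-homs⇒↛ {F} {H} {r} r<χ c hom⇒colourable F⟶H
  with S , iso , _ ← F⟶H (record { colour = λ _ _ _ → c ; colour-sym = λ _ _ _ _ → refl }) =
  <⇒≱ r<χ (χ-isChromaticNumber H .proj₂ r (hom⇒colourable to′ λ x y xy →
    Subgraph.edge⊆Adj S _ _ (Equivalence.to (_≅_.adjacency iso x y) xy)))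
  where to′ = _≅_.to iso

toGraph-locallyColourable : ∀ {r n} C → DecGraph.LocallyColourable C r n → ∀ (H : Graph) →
  Graph.order H ≤ n → (h : Vertex H → Vertex (toGraph C)) →
  (∀ x y → Adj H x y → Adj (toGraph C) (h x) (h y)) → Colourable H r
toGraph-locallyColourable C local H order≤n h hom =
  let c , proper = local (List.map (element finite ∘ h) (allFin (Graph.order H)))
        (≤-trans (≤-reflexive (trans (length-map _ (allFin (Graph.order H))) (length-tabulate {n = Graph.order H} id))) order≤n)
  in c ∘ element finite ∘ h , λ x y xy →
       proper (∈-map⁺ _ (∈-allFin x)) (∈-map⁺ _ (∈-allFin y)) (toWitness (hom x y xy))
  where open DecGraph C

edgeless-arrows : ∀ (G : Graph) {q} → ¬ (∃[ x ] ∃[ y ] Adj G x y) → G ⟶⟨ G ⟩ suc q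
edgeless-arrows G edgeless κ =
  monochromatic-image G G κ id id zero λ x y xy → contradiction (x , y , xy) edgeless

theorem7 : (G H : Graph) → χ G < χ H →
    (q : ℕ) → 2 ≤ q → ∃[ F ] (F ⟶⟨ G ⟩ q × F ↛⟨ H ⟩ q)
theorem7 G H χG<χH (suc q) _
  with χ-isChromaticNumber G .proj₁ | any? (λ x → any? λ y → T? (Graph.adj G x y))
-- Without an edge to serve as `x₀ y₀`, `G` itself is taken: homomorphisms from `H` pull `c₀` back.
... | c₀ , c₀-proper | no edgeless = G , edgeless-arrows G edgeless ,
  no-homs⇒↛ χG<χH zero λ h hom → c₀ ∘ h , λ x y xy → c₀-proper _ _ (hom x y xy)
... | c₀ , c₀-proper | yes (x₀ , y₀ , x₀y₀) =
  let C , local , arrows = sparse-embedding G c₀ c₀-proper x₀y₀ (suc q) (Graph.order H)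
  in toGraph C , toGraph-arrows G c₀ c₀-proper x₀y₀ zero C arrows ,
     -- The final round of `sparse-embedding` raises the bound by one, whence `suc`.
     no-homs⇒↛ χG<χH zero (toGraph-locallyColourable {n = suc (Graph.order H)} C local H (n≤1+n _))
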